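{- Let $G$ be a graph with $\chi_P(G)=k$ and $|V(G)|=n$. For all integers $\ell$ and $m$ such that $m\ge n+k+2$ and $\ell\ge m(n+1)+k+3$, the path-chromatic number of $R_\ell(R_m(G))$ is strictly larger than $k$.
   Context: Graphs are finite and simple; $[m]=\{1,\dots,m\}$. A path-decomposition of a graph $G$ is a sequence $B_1,\dots,B_s$ of subsets of $V(G)$ (bags) such that $V(G)=\bigcup_t B_t$; for each $uv\in E(G)$ there is $t$ with $u,v\in B_t$; and for each $v\in V(G)$ the sets $B_t$ containing $v$ are consecutive in the sequence. The chromatic number of a path-decomposition is $\max_t \chi(G[B_t])$. The path-chromatic number $\chi_P(G)$ is the minimum chromatic number over all path-decompositions of $G$. For a graph $G$ and a positive integer $m$, $R_m(G)$ is the graph with vertex set $\{(i,v): i\in[m],\ v\in V(G)\cup\{v_0\}\}$, where $v_0\notin V(G)$ is a new element, in which two distinct vertices $(i,v)$ and $(i',v')$ are adjacent if and only if either $i=i'$ and exactly one of $v,v'$ equals $v_0$, or $i\ne i'$, $v,v'\in V(G)$ and $vv'\in E(G)$. (In $R_\ell(R_m(G))$ the construction is applied to the graph $R_m(G)$, with a new element not in $V(R_m(G))$.) -}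

module Defs where

open import Data.Bool.Base using (Bool; T; _xor_)
open import Data.Bool.Properties using (T?; xor-comm; xor-same)
open import Data.Empty using (⊥)
open import Data.Fin.Base using (Fin) renaming (_≤_ to _≤ᶠ_)
import Data.Fin.Properties as Fin
open import Data.Maybe.Base using (Maybe; just; nothing; is-nothing)
open import Data.Nat.Base using (ℕ; _≤_)
open import Data.Product.Base using (Σ-syntax; ∃-syntax; _×_; _,_; proj₁)
open import Data.Sum.Base using (_⊎_; inj₁; inj₂)
open import Function.Base using (_on_)
open import Relation.Binary.Core using (Rel)
open import Relation.Binary.Definitions using (Symmetric; Decidable)
open import Relation.Binary.PropositionalEquality
  using (_≡_; _≢_; refl; sym; subst; ≢-sym)
open import Relation.Nullary using (¬_; yes; no; ¬?)
open import Relation.Nullary.Decidable using (_×-dec_; _⊎-dec_)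
open import Level using (0ℓ)

IsMinimum : (ℕ → Set) → ℕ → Set
IsMinimum P k = P k × (∀ j → P j → k ≤ j)

IsMaximum : (ℕ → Set) → ℕ → Set
IsMaximum P k = P k × (∀ j → P j → j ≤ k)

-- Simple graphs. Finiteness is not a field: "V(G) is finite with n elements"
-- is expressed by a bijection Vertex G ↔ Fin n.
record Graph : Set₁ where
  infix 4 _~_
  field
    Vertex   : Set
    _~_      : Rel Vertex 0ℓ
    ~-sym    : Symmetric _~_
    ~-irrefl : ∀ {v} → ¬ (v ~ v)
    _~?_     : Decidable _~_

open Graph public using (Vertex)

-- Vertex sets are Boolean-valued, so that membership is decidable and
-- proof-irrelevant; in particular Σ[ v ∈ Vertex G ] v ∈ B has exactly one
-- element for each member of B.
VertexSet : Graph → Set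
VertexSet G = Vertex G → Bool

infix 4 _∈_
_∈_ : ∀ {A : Set} → A → (A → Bool) → Set
v ∈ B = T (B v)

infix 10 _[_]
_[_] : (G : Graph) → VertexSet G → Graph
G [ B ] = record
  { Vertex   = Σ[ v ∈ Vertex G ] v ∈ B
  ; _~_      = _~_ on proj₁
  ; ~-sym    = ~-sym
  ; ~-irrefl = ~-irrefl
  ; _~?_     = λ u v → proj₁ u ~? proj₁ v
  }
  where open Graph G hiding (Vertex)

Colouring : Graph → ℕ → Set
Colouring G c =
  Σ[ f ∈ (Vertex G → Fin c) ] (∀ u v → u ~ v → f u ≢ f v)
  where open Graph G hiding (Vertex)

IsChromaticNumber : Graph → ℕ → Set
IsChromaticNumber G = IsMinimum (Colouring G)

record PathDecomposition (G : Graph) : Set where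
  open Graph G using (_~_)
  field
    length      : ℕ
    bag         : Fin length → VertexSet G
    covers      : ∀ v → ∃[ t ] v ∈ bag t
    coversEdges : ∀ u v → u ~ v → ∃[ t ] (u ∈ bag t × v ∈ bag t)
    consecutive : ∀ v r s t → r ≤ᶠ s → s ≤ᶠ t →
                  v ∈ bag r → v ∈ bag t → v ∈ bag s

-- The empty sequence of bags (possible only if G has no vertices) has no
-- chromatic number, as the maximum of an empty set does not exist; the graph
-- without vertices still has the decomposition into one empty bag.
IsDecompositionChromaticNumber : {G : Graph} → PathDecomposition G → ℕ → Set
IsDecompositionChromaticNumber {G} D =
  IsMaximum (λ c → ∃[ t ] IsChromaticNumber (G [ bag t ]) c)
  where open PathDecomposition D

IsPathChromaticNumber : Graph → ℕ → Set
IsPathChromaticNumber G =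
  IsMinimum (λ c → Σ[ D ∈ PathDecomposition G ] IsDecompositionChromaticNumber D c)

-- In R m G, the element v₀ is `nothing` and v ∈ V(G) is `just v`; [m] is Fin m.
module _ (G : Graph) where
  open Graph G hiding (Vertex)

  BothInGAndAdjacent : Rel (Maybe (Vertex G)) 0ℓ
  BothInGAndAdjacent (just u) (just v) = u ~ v
  BothInGAndAdjacent _        _        = ⊥

  ExactlyOneIsV₀ : Rel (Maybe (Vertex G)) 0ℓ
  ExactlyOneIsV₀ u v = T (is-nothing u xor is-nothing v)

  -- Distinctness of the two vertices is implied by either alternative.
  RAdjacent : (m : ℕ) → Rel (Fin m × Maybe (Vertex G)) 0ℓ
  RAdjacent m (i , u) (j , v) =
    (i ≡ j × ExactlyOneIsV₀ u v) ⊎ (i ≢ j × BothInGAndAdjacent u v)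

  both-sym : ∀ u v → BothInGAndAdjacent u v → BothInGAndAdjacent v u
  both-sym (just _) (just _) = ~-sym

  both? : Decidable BothInGAndAdjacent
  both? (just u) (just v) = u ~? v
  both? (just _) nothing  = no λ ()
  both? nothing  _        = no λ ()

  R-sym : ∀ {m} x y → RAdjacent m x y → RAdjacent m y x
  R-sym (_ , u) (_ , v) (inj₁ (i≡j , p)) =
    inj₁ (sym i≡j , subst T (xor-comm (is-nothing u) (is-nothing v)) p)
  R-sym (_ , u) (_ , v) (inj₂ (i≢j , p)) = inj₂ (≢-sym i≢j , both-sym u v p)

  R-irrefl : ∀ {m} x → ¬ RAdjacent m x x
  R-irrefl (_ , v) (inj₁ (_ , p)) = subst T (xor-same (is-nothing v)) p
  R-irrefl _ (inj₂ (i≢i , _)) = i≢i refl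

  R-dec : ∀ {m} → Decidable (RAdjacent m)
  R-dec (i , u) (j , v) =
    ((i Fin.≟ j) ×-dec T? (is-nothing u xor is-nothing v))
      ⊎-dec (¬? (i Fin.≟ j) ×-dec both? u v)

R : ℕ → Graph → Graph
R m G = record
  { Vertex   = Fin m × Maybe (Vertex G)
  ; _~_      = RAdjacent G m
  ; ~-sym    = λ {x} {y} → R-sym G x y
  ; ~-irrefl = λ {x} → R-irrefl G x
  ; _~?_     = R-dec G
  }

{-# OPTIONS --safe #-}
-- A path-decomposition with k-colourable bags is handled as an interval model.
-- Let H = R m G, and suppose that R ℓ H has an interval model with k colours.
-- Order the rows by the intervals J i of their centres (i , v₀).
--
-- If a bag meets J i and enough intervals J lie on either side of it, then every
-- column of H that is well represented in the bag has a repeated colour, and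
-- repeated colours properly colour those columns. The remaining columns are
-- independent with all neighbours present in row i, so they can get the colour
-- of the centre of row i once row i has replaced that colour on the neighbours.
-- Hence H is k-colourable, and the same replacement, with a whole row of H,
-- makes G (k − 1)-colourable.
--
-- Otherwise the J of many rows share an interval [z′ , z], and H has a model
-- with k − 1 colours in which some intervals are empty; each empty interval
-- marks a time at which all neighbours of its vertex are present. Choose a copy
-- of G in H, with empty intervals only where another row's copies of the same
-- vertex end before and start after. Such a vertex gets a bag of its own, where
-- it takes the colour of the centre of its row, again by replacement.
--
-- Either way G has a path-decomposition with (k − 1)-colourable bags.
module Submission where

open import Defs
open import Data.Bool.Properties using (T?)
open import Data.Fin.Base
  using (Fin; zero; suc; toℕ; fromℕ; fromℕ<; inject₁; inject≤; punchIn;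
         combine; remQuot; finToFun; funToFin; _↑ˡ_; _↑ʳ_)
open import Data.Fin.Properties using (_≟_; all?; any?; ¬∀⟶∃¬)
import Data.Fin.Properties as Fin
open import Data.Maybe.Base using (Maybe; just; nothing)
import Data.Maybe.Base as Maybe
open import Data.Nat.Base
open import Data.Nat.DivMod using (m<n*o⇒m/o<n; /-monoˡ-≤; m*n/n≡m)
open import Data.Nat.Properties hiding (_≟_)
import Data.Nat.Properties as ℕ
open import Data.Nat.Tactic.RingSolver using (solve-∀)
open import Data.Product.Base using (Σ-syntax; ∃; ∃-syntax; _×_; _,_; proj₁; proj₂)
open import Data.Sum.Base using (_⊎_; inj₁; inj₂; [_,_]′)
open import Data.Unit.Base using (⊤; tt)
open import Function.Base using (_∘_; case_of_; const; flip; id)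
open import Function.Bundles using (_↔_; Inverse)
open import Function.Definitions using (Injective)
open import Relation.Binary.Definitions using (Total; Transitive)
open import Relation.Binary.PropositionalEquality hiding ([_])
open import Relation.Nullary using (¬_; Dec; yes; no; contradiction)
open import Relation.Nullary.Decidable
  using (_×-dec_; _⊎-dec_; _→-dec_; ¬?; map′; toWitness; fromWitness; ⌊_⌋)
open import Relation.Unary using (Decidable)

Adj : (G : Graph) → Vertex G → Vertex G → Set
Adj = Graph._~_

-- Least elements, selection and choice

least : {P : ℕ → Set} → Decidable P → ∀ n → P n → ∃[ m ] IsMinimum P m
least P? zero p = zero , p , λ _ _ → z≤n
least {P} P? (suc n) p with P? 0
... | yes p₀ = zero , p₀ , λ _ _ → z≤n
... | no ¬p₀ with least (P? ∘ suc) n p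
...   | m , pm , min = suc m , pm , λ where
          zero    p₀ → contradiction p₀ ¬p₀
          (suc j) pj → s≤s (min j pj)

argminOn : ∀ {n} {P : Fin n → Set} {_≼_ : Fin n → Fin n → Set} →
  Total _≼_ → Transitive _≼_ → Decidable P → ∃ P → ∃[ x ] (P x × ∀ y → P y → x ≼ y)
argminOn {zero} total trans P? (() , _)
argminOn {suc n} {P} {_≼_} total trans P? (x , px) with any? (P? ∘ suc)
... | no none = zero , only x px , λ where
    zero    _  → [ id , id ]′ (total zero zero)
    (suc y) py → contradiction (y , py) none
  where
  only : ∀ x → P x → P zero
  only zero    p = p
  only (suc y) p = contradiction (y , p) none
... | yes some with argminOn {_≼_ = λ x y → suc x ≼ suc y} (λ x y → total (suc x) (suc y)) trans
                      (P? ∘ suc) some | P? zero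
...   | y , py , min | no ¬p₀ = suc y , py , λ where
          zero    p₀ → contradiction p₀ ¬p₀
          (suc w) pw → min w pw
...   | y , py , min | yes p₀ with total zero (suc y)
...     | inj₁ 0≼y = zero , p₀ , λ where
            zero    _  → [ id , id ]′ (total zero zero)
            (suc w) pw → trans 0≼y (min w pw)
...     | inj₂ y≼0 = suc y , py , λ where
            zero    _  → y≼0
            (suc w) pw → min w pw

argmin : ∀ {n} {_≼_ : Fin (suc n) → Fin (suc n) → Set} →
         Total _≼_ → Transitive _≼_ → ∃[ x ] ∀ y → x ≼ y
argmin total trans with argminOn {P = λ _ → ⊤} total trans (λ _ → yes tt) (zero , tt)
... | x , _ , min = x , λ y → min y tt

consPunchIn : ∀ {m n} → Fin (suc n) → (Fin m → Fin n) → Fin (suc m) → Fin (suc n)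
consPunchIn x e zero    = x
consPunchIn x e (suc y) = punchIn x (e y)

consPunchIn-injective : ∀ {m n} (x : Fin (suc n)) {e : Fin m → Fin n} →
  Injective _≡_ _≡_ e → Injective _≡_ _≡_ (consPunchIn x e)
consPunchIn-injective x e-inj {zero}  {zero}  _  = refl
consPunchIn-injective x e-inj {zero}  {suc j} eq = contradiction (sym eq) (Fin.punchInᵢ≢i x _)
consPunchIn-injective x e-inj {suc i} {zero}  eq = contradiction eq (Fin.punchInᵢ≢i x _)
consPunchIn-injective x e-inj {suc i} {suc j} eq =
  cong suc (e-inj (Fin.punchIn-injective x _ _ eq))

-- Selection sort stopped once position `a` is filled. Only comparisons with this pivot are
-- recorded.
selectSmallest : ∀ a b {_≼_ : Fin (a + suc b) → Fin (a + suc b) → Set} →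
  Total _≼_ → Transitive _≼_ →
  Σ[ e ∈ (Fin (a + suc b) → Fin (a + suc b)) ]
    Injective _≡_ _≡_ e ×
    (∀ x → e (x ↑ˡ suc b) ≼ e (a ↑ʳ zero)) ×
    (∀ y → e (a ↑ʳ zero) ≼ e (a ↑ʳ y))
selectSmallest zero b total trans with argmin total trans
... | x , min =
  consPunchIn x (λ y → y) , consPunchIn-injective x (λ eq → eq) , (λ ()) , (λ y → min _)
selectSmallest (suc a) b {_≼_} total trans with argmin {a + suc b} {_≼_} total trans
... | x , min
  with selectSmallest a b {λ i j → punchIn x i ≼ punchIn x j} (λ i j → total _ _) trans
...   | e , e-inj , below , above =
  consPunchIn x e , consPunchIn-injective x e-inj ,
  (λ { zero → min _ ; (suc y) → below y }) , above

choose : {V : Set} {P : V → Set} {Q : V → ℕ → Set} → Decidable P →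
         (∀ v → P v → ∃ (Q v)) → Σ[ f ∈ (V → ℕ) ] (∀ v → P v → Q v (f v))
choose {V} {P} {Q} P? q = f , f-spec
  where
  f : V → ℕ
  f v with P? v
  ... | yes p = proj₁ (q v p)
  ... | no  _ = 0
  f-spec : ∀ v → P v → Q v (f v)
  f-spec v p with P? v
  ... | yes p′ = proj₂ (q v p′)
  ... | no ¬p  = contradiction p ¬p

-- Colourings of vertex sets

ProperOn : (G : Graph) → (Vertex G → Set) → (Vertex G → ℕ) → Set
ProperOn G S f = ∀ u w → S u → S w → Adj G u w → f u ≢ f w

record ColourableOn (G : Graph) (c : ℕ) (S : Vertex G → Set) : Set where
  constructor colouring
  field
    colour : Vertex G → ℕ
    bound  : ∀ v → S v → colour v < c
    proper : ProperOn G S colour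

open ColourableOn

record Hom (G G′ : Graph) : Set where
  field
    map       : Vertex G → Vertex G′
    preserves : ∀ u w → Adj G u w → Adj G′ (map u) (map w)

idHom : ∀ {G} → Hom G G
idHom = record { map = λ v → v ; preserves = λ _ _ u~w → u~w }

pullback : ∀ {G G′ c S S′} (φ : Hom G G′) → (∀ v → S v → S′ (Hom.map φ v)) →
  ColourableOn G′ c S′ → ColourableOn G c S
pullback φ S⊆S′ C = record
  { colour = colour C ∘ map
  ; bound  = λ v → bound C (map v) ∘ S⊆S′ v
  ; proper = λ u w Su Sw u~w →
      proper C (map u) (map w) (S⊆S′ u Su) (S⊆S′ w Sw) (preserves u w u~w)
  }
  where open Hom φ

restrict : ∀ {G c S S′} → (∀ v → S v → S′ v) → ColourableOn G c S′ → ColourableOn G c S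
restrict = pullback idHom

-- The vertices of colour c in D take the alternative colour e. As they are
-- independent, only the conflicts between e and f matter.
recolour : ∀ {G k S} {D : Vertex G → Set} (D? : Decidable D) (c : ℕ)
  (C : ColourableOn G k S) (e : Vertex G → ℕ) →
  (∀ u → S u → D u → e u < k) →
  (∀ u → S u → D u → e u ≢ c) →
  (∀ u w → S u → D u → S w → Adj G u w → e u ≢ colour C w) →
  Σ[ C′ ∈ ColourableOn G k S ] (∀ u → S u → D u → colour C′ u ≢ c)
recolour {G} {k} {S} {D} D? c C e e<k e≢c e≢f =
  record { colour = h ; bound = h<k ; proper = h-proper } , avoids
  where
  f = colour C
  h : Vertex G → ℕ
  h u with (f u ℕ.≟ c) ×-dec D? u
  ... | yes _ = e u
  ... | no  _ = f u
  h<k : ∀ u → S u → h u < k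
  h<k u Su with (f u ℕ.≟ c) ×-dec D? u
  ... | yes (_ , Du) = e<k u Su Du
  ... | no  _        = bound C u Su
  h-proper : ProperOn G S h
  h-proper u w Su Sw u~w with (f u ℕ.≟ c) ×-dec D? u | (f w ℕ.≟ c) ×-dec D? w
  ... | yes (fu≡c , _) | yes (fw≡c , _) =
    contradiction (trans fu≡c (sym fw≡c)) (proper C u w Su Sw u~w)
  ... | yes (_ , Du)   | no _           = e≢f u w Su Du Sw u~w
  ... | no _           | yes (_ , Dw)   = e≢f w u Sw Dw Su (Graph.~-sym G u~w) ∘ sym
  ... | no _           | no _           = proper C u w Su Sw u~w
  avoids : ∀ u → S u → D u → h u ≢ c
  avoids u Su Du with (f u ℕ.≟ c) ×-dec D? u
  ... | yes _ = e≢c u Su Du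
  ... | no ¬p = λ fu≡c → ¬p (fu≡c , Du)

dropColour : ∀ {G k S c} (C : ColourableOn G (suc k) S) → c < suc k →
  (∀ u → S u → colour C u ≢ c) → ColourableOn G k S
dropColour {G} {k} {S} {c} C c<1+k f≢c = record { colour = h ; bound = h<k ; proper = h-proper }
  where
  f = colour C
  h : Vertex G → ℕ
  h u with f u ℕ.≟ k
  ... | yes _ = c
  ... | no  _ = f u
  h<k : ∀ u → S u → h u < k
  h<k u Su with f u ℕ.≟ k
  ... | yes fu≡k = ≤∧≢⇒< (s≤s⁻¹ c<1+k) (λ c≡k → f≢c u Su (trans fu≡k (sym c≡k)))
  ... | no  fu≢k = ≤∧≢⇒< (s≤s⁻¹ (bound C u Su)) fu≢k
  h-proper : ProperOn G S h
  h-proper u w Su Sw u~w with f u ℕ.≟ k | f w ℕ.≟ k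
  ... | yes fu≡k | yes fw≡k = contradiction (trans fu≡k (sym fw≡k)) (proper C u w Su Sw u~w)
  ... | yes _    | no _     = f≢c w Sw ∘ sym
  ... | no _     | yes _    = f≢c u Su
  ... | no _     | no _     = proper C u w Su Sw u~w

addColour : ∀ {G k S c} {X : Vertex G → Set} → Decidable X →
  (C : ColourableOn G k S) → c < k →
  (∀ u w → X u → X w → ¬ Adj G u w) →
  (∀ u w → X u → S w → Adj G u w → colour C w ≢ c) →
  ColourableOn G k (λ v → S v ⊎ X v)
addColour {G} {k} {S} {c} {X} X? C c<k X-indep f≢c =
  record { colour = h ; bound = h<k ; proper = h-proper }
  where
  f = colour C
  h : Vertex G → ℕ
  h u with X? u
  ... | yes _ = c
  ... | no  _ = f u
  inS : ∀ {u} → ¬ X u → S u ⊎ X u → S u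
  inS ¬Xu (inj₁ Su) = Su
  inS ¬Xu (inj₂ Xu) = contradiction Xu ¬Xu
  h<k : ∀ u → S u ⊎ X u → h u < k
  h<k u Su with X? u
  ... | yes _  = c<k
  ... | no ¬Xu = bound C u (inS ¬Xu Su)
  h-proper : ProperOn G (λ v → S v ⊎ X v) h
  h-proper u w Su Sw u~w with X? u | X? w
  ... | yes Xu | yes Xw = contradiction u~w (X-indep u w Xu Xw)
  ... | yes Xu | no ¬Xw = f≢c u w Xu (inS ¬Xw Sw) u~w ∘ sym
  ... | no ¬Xu | yes Xw = f≢c w u Xw (inS ¬Xu Su) (Graph.~-sym G u~w)
  ... | no ¬Xu | no ¬Xw = proper C u w (inS ¬Xu Su) (inS ¬Xw Sw) u~w

-- Interval models

-- A path-decomposition as an assignment of intervals [lo v , hi v], with bag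
-- {v | lo v ≤ t ≤ hi v} at time t. In a weak model some intervals may be empty.
record WeakModel (G : Graph) (c : ℕ) : Set where
  field
    lo hi      : Vertex G → ℕ
    meet       : ∀ {u w} → Adj G u w → lo u ≤ hi w
    colourable : ∀ t → ColourableOn G c (λ v → lo v ≤ t × t ≤ hi v)

record IntervalModel (G : Graph) (c : ℕ) : Set where
  field
    weakModel : WeakModel G c
  open WeakModel weakModel public
  field
    lo≤hi : ∀ v → lo v ≤ hi v

pigeonhole< : ∀ {k n} → k < n → (f : Fin n → ℕ) → (∀ a → f a < k) →
  ∃[ a ] ∃[ b ] (a ≢ b × f a ≡ f b)
pigeonhole< k<n f f<k with Fin.pigeonhole k<n (λ a → fromℕ< (f<k a))
... | a , b , a<b , eq =
  a , b , Fin.<⇒≢ a<b , Fin.fromℕ<-injective _ _ (f<k a) (f<k b) eq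

-- Repeated colours in the columns

module Rows (H : Graph) (k ℓ : ℕ) (M : IntervalModel (R ℓ H) k) where
  open IntervalModel M using (meet; colourable)

  lo hi : Fin ℓ → Vertex H → ℕ
  lo i u = IntervalModel.lo M (i , just u)
  hi i u = IntervalModel.hi M (i , just u)

  l r : Fin ℓ → ℕ
  l i = IntervalModel.lo M (i , nothing)
  r i = IntervalModel.hi M (i , nothing)

  Covers : ℕ → Fin ℓ → Vertex H → Set
  Covers t i u = lo i u ≤ t × t ≤ hi i u

  Covers? : ∀ t i u → Dec (Covers t i u)
  Covers? t i u = (lo i u ≤? t) ×-dec (t ≤? hi i u)

  CoversCentre : ℕ → Fin ℓ → Set
  CoversCentre t i = l i ≤ t × t ≤ r i

  g : ℕ → Fin ℓ → Vertex H → ℕ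
  g t i u = colour (colourable t) (i , just u)

  centre : ℕ → Fin ℓ → ℕ
  centre t i = colour (colourable t) (i , nothing)

  lo≤hi : ∀ {i j u w} → i ≢ j → Adj H u w → lo i u ≤ hi j w
  lo≤hi i≢j u~w = meet (inj₂ (i≢j , u~w))

  lo≤r : ∀ i u → lo i u ≤ r i
  lo≤r i u = meet (inj₁ (refl , tt))

  l≤hi : ∀ i u → l i ≤ hi i u
  l≤hi i u = meet (inj₁ (refl , tt))

  l≤r : ∀ i → l i ≤ r i
  l≤r i = IntervalModel.lo≤hi M (i , nothing)

  g<k : ∀ {t i u} → Covers t i u → g t i u < k
  g<k {t} = bound (colourable t) _

  centre<k : ∀ {t i} → CoversCentre t i → centre t i < k
  centre<k {t} = bound (colourable t) _

  g≢g : ∀ {t i j u w} → Covers t i u → Covers t j w → i ≢ j → Adj H u w → g t i u ≢ g t j w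
  g≢g {t} p q i≢j u~w = proper (colourable t) _ _ p q (inj₂ (i≢j , u~w))

  g≢centre : ∀ {t i u} → Covers t i u → CoversCentre t i → g t i u ≢ centre t i
  g≢centre {t} p q = proper (colourable t) _ _ p q (inj₁ (refl , tt))

  -- A colour occurring twice in the column of u conflicts with every
  -- occurrence of that colour in the column of a neighbour.
  RobustColour : ℕ → Vertex H → ℕ → Set
  RobustColour t u x =
    ∃[ p ] ∃[ q ] (p ≢ q × Covers t p u × Covers t q u × g t p u ≡ x × g t q u ≡ x)

  robust≢ : ∀ {t u w j x} → RobustColour t u x → Covers t j w → Adj H u w → g t j w ≢ x
  robust≢ {j = j} (p , q , p≢q , pu , qu , gp , gq) jw u~w eq with p ≟ j
  ... | no p≢j = g≢g pu jw p≢j u~w (trans gp (sym eq))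
  ... | yes p≡j = g≢g qu jw (λ q≡j → p≢q (trans p≡j (sym q≡j))) u~w (trans gq (sym eq))

  robust< : ∀ {t u x} → RobustColour t u x → x < k
  robust< (_ , _ , _ , pu , _ , refl , _) = g<k pu

  avoidRow : (α : Fin (suc (suc k)) → Fin ℓ) → Injective _≡_ _≡_ α → ∀ q →
    ∃[ b ] ∀ a → α (punchIn b a) ≢ q
  avoidRow α α-inj q with any? (λ b → α b ≟ q)
  ... | yes (b , αb≡q) = b , λ a eq → Fin.punchInᵢ≢i b a (α-inj (trans eq (sym αb≡q)))
  ... | no ¬∃          = zero , λ a eq → ¬∃ (_ , eq)

  -- Dropping one row, namely `q` if it occurs in `α`, leaves `k + 1` covering rows for `k` colours.
  robust : ∀ {t u} (α : Fin (suc (suc k)) → Fin ℓ) → Injective _≡_ _≡_ α →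
    ∀ q → (∀ a → α a ≢ q → Covers t (α a) u) → ∃ (RobustColour t u)
  robust {t} {u} α α-inj q cov with avoidRow α α-inj q
  ... | b , α≢q
    with pigeonhole< (n<1+n k) (λ a → g t (α (punchIn b a)) u) (λ a → g<k (cov _ (α≢q a)))
  ...   | a , a′ , a≢a′ , eq =
    g t (α (punchIn b a)) u , α (punchIn b a) , α (punchIn b a′) ,
    (λ eq′ → a≢a′ (Fin.punchIn-injective b a a′ (α-inj eq′))) ,
    cov _ (α≢q a) , cov _ (α≢q a′) , refl , sym eq

  -- Row `j` then offers `u` the colour `g t j u`, which differs from the colour `c` of the adjacent
  -- centre.
  Alternative : ℕ → ℕ → Vertex H → Fin ℓ → Set
  Alternative t c u j = Covers t j u × CoversCentre t j × centre t j ≡ c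

  Alternative? : ∀ t c u j → Dec (Alternative t c u j)
  Alternative? t c u j =
    Covers? t j u ×-dec (((l j ≤? t) ×-dec (t ≤? r j)) ×-dec (centre t j ℕ.≟ c))

  -- Repeated colours are proper on `S`. A vertex of colour `c` moves to its colour in `row u`,
  -- which cannot equal a repeated colour of a neighbour. The row may vary with `u`, as only the
  -- colour of the centre matters.
  avoidCentre : ∀ t c {S : Vertex H → Set} → Decidable S →
    (∀ u → S u → ∃ (RobustColour t u)) → (row : Vertex H → Fin ℓ) →
    Σ[ C ∈ ColourableOn H k S ] (∀ u → S u → Alternative t c u (row u) → colour C u ≢ c)
  avoidCentre t c {S} S? rob row =
    recolour (λ u → Alternative? t c u (row u)) c
      (record
        { colour = f
        ; bound  = λ u Su → robust< (f-robust u Su)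
        ; proper = λ u w Su Sw → robust-proper (f-robust u Su) (f-robust w Sw)
        })
      (λ u → g t (row u) u)
      (λ u Su (cov , _) → g<k cov)
      (λ { u Su (cov , ctr , refl) → g≢centre cov ctr })
      (λ u w Su (cov , _) Sw u~w → robust≢ (f-robust w Sw) cov (Graph.~-sym H u~w))
    where
    f : Vertex H → ℕ
    f = proj₁ (choose S? rob)
    f-robust : ∀ u → S u → RobustColour t u (f u)
    f-robust = proj₂ (choose S? rob)
    robust-proper : ∀ {u w x y} → RobustColour t u x → RobustColour t w y → Adj H u w → x ≢ y
    robust-proper ρ (_ , _ , _ , pw , _ , gp , _) u~w refl = robust≢ ρ pw u~w gp

-- The dichotomy for R ℓ H

-- Rows are split according to the intervals [l x , r x]: the rows α end first,
-- i is the next to end, and z is the end of row i. Among the remaining rows, the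
-- rows β start last, j starts just before them at time z′, and γ are left over.
record RowSplit (a b c ℓ : ℕ) (l r : Fin ℓ → ℕ) : Set where
  field
    α     : Fin a → Fin ℓ
    β     : Fin b → Fin ℓ
    γ     : Fin c → Fin ℓ
    i j   : Fin ℓ
    α-inj : Injective _≡_ _≡_ α
    β-inj : Injective _≡_ _≡_ β
    γ-inj : Injective _≡_ _≡_ γ
    i≢j   : i ≢ j
    i≢α   : ∀ a → i ≢ α a
    i≢β   : ∀ b → i ≢ β b
    α≢β   : ∀ a b → α a ≢ β b
    α≢j   : ∀ a → α a ≢ j
    γ≢j   : ∀ q → γ q ≢ j
    α≤z   : ∀ a → r (α a) ≤ r i
    z≤γ   : ∀ q → r i ≤ r (γ q)
    z′≤β  : ∀ b → l j ≤ l (β b)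
    γ≤z′  : ∀ q → l (γ q) ≤ l j

-- `2 + k` rows each for `α` and `β`, as `robust` requires; `1 + k` rows `γ`, so that two centres
-- share a colour; and the rows `i` and `j`.
rowCount : ℕ → ℕ
rowCount k = (2 + k) + suc ((2 + k) + suc (1 + k))

↑ˡ≢↑ʳ : ∀ {m n} {x : Fin m} {y : Fin n} → x ↑ˡ n ≢ m ↑ʳ y
↑ˡ≢↑ʳ {suc m} {x = suc x} eq = ↑ˡ≢↑ʳ (Fin.suc-injective eq)

splitRows : ∀ a b c (l r : Fin (a + suc (b + suc c)) → ℕ) →
  RowSplit a b c (a + suc (b + suc c)) l r
splitRows a b c l r
  with selectSmallest a (b + suc c) {λ x y → r x ≤ r y}
         (λ _ _ → ≤-total _ _) ≤-trans
... | e , e-inj , e-below , e-above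
  with selectSmallest b c
         {λ x y → l (e (a ↑ʳ suc y)) ≤ l (e (a ↑ʳ suc x))}
         (λ _ _ → ≤-total _ _) (flip ≤-trans)
... | e′ , e′-inj , e′-below , e′-above = record
  { α     = λ x → e (x ↑ˡ _)
  ; β     = λ x → rest (e′ (x ↑ˡ _))
  ; γ     = λ q → rest (e′ (b ↑ʳ suc q))
  ; i     = e (a ↑ʳ zero)
  ; j     = rest (e′ (b ↑ʳ zero))
  ; α-inj = λ eq → Fin.↑ˡ-injective _ _ _ (e-inj eq)
  ; β-inj = λ eq → Fin.↑ˡ-injective _ _ _ (e′-inj (rest-inj eq))
  ; γ-inj = λ eq → Fin.suc-injective (Fin.↑ʳ-injective b _ _ (e′-inj (rest-inj eq)))
  ; i≢j   = i≢rest _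
  ; i≢α   = λ x eq → ↑ˡ≢↑ʳ (sym (e-inj eq))
  ; i≢β   = λ x → i≢rest _
  ; α≢β   = λ x y eq → ↑ˡ≢↑ʳ (e-inj eq)
  ; α≢j   = λ x eq → ↑ˡ≢↑ʳ (e-inj eq)
  ; γ≢j   = λ q eq → Fin.0≢1+n (Fin.↑ʳ-injective b _ _ (e′-inj (rest-inj (sym eq))))
  ; α≤z   = e-below
  ; z≤γ   = λ q → e-above _
  ; z′≤β  = e′-below
  ; γ≤z′  = λ q → e′-above (suc q)
  }
  where
  rest : Fin (b + suc c) → Fin (a + suc (b + suc c))
  rest y = e (a ↑ʳ suc y)
  rest-inj : Injective _≡_ _≡_ rest
  rest-inj eq = Fin.suc-injective (Fin.↑ʳ-injective a _ _ (e-inj eq))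
  i≢rest : ∀ y → e (a ↑ʳ zero) ≢ rest y
  i≢rest y eq = Fin.0≢1+n (Fin.↑ʳ-injective a _ _ (e-inj eq))

-- Truncation of the time axis

module _ {z′ z : ℕ} (z′≤z : z′ ≤ z) where
  -- The time axis is cut down to [z′ , z] and shifted by one; the new first
  -- time z′ collects all that has started by z′ and the new last time 2 + z
  -- all that ends after z.
  shiftStart shiftEnd : ℕ → ℕ
  shiftStart x with x ≤? z′
  ... | yes _ = z′
  ... | no  _ = suc (x ⊓ suc z)
  shiftEnd y with z ≤? y | z′ ≤? y
  ... | yes _ | _     = 2 + z
  ... | no _  | yes _ = suc y
  ... | no _  | no _  = z′

  -- The cap `x ⊓ suc z` keeps shifted starts at most `2 + z`, the shifted end of all that lasts
  -- until `z`.
  shift-mono : ∀ {x y} → x ≤ y → shiftStart x ≤ shiftEnd y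
  shift-mono {x} {y} x≤y with x ≤? z′ | z ≤? y | z′ ≤? y
  ... | yes _ | yes _ | _     = ≤-trans z′≤z (m≤n+m z 2)
  ... | yes _ | no _  | yes z′≤y = m≤n⇒m≤1+n z′≤y
  ... | yes _ | no _  | no _  = ≤-refl
  ... | no _  | yes _ | _     = s≤s (m⊓n≤n x (suc z))
  ... | no _  | no _  | yes _ = s≤s (≤-trans (m⊓n≤m x (suc z)) x≤y)
  ... | no x≰ | no _  | no z′≰y = contradiction (≤-trans x≤y (≰⇒≥ z′≰y)) x≰

  data Phase (s : ℕ) : Set where
    early   : (∀ x → shiftStart x ≤ s → x ≤ z′) → Phase s
    middle  : ∀ t → z′ ≤ t → t ≤ z →
              (∀ x y → shiftStart x ≤ s × s ≤ shiftEnd y → x ≤ t × t ≤ y) → Phase s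
    late    : (∀ y → s ≤ shiftEnd y → z ≤ y) → Phase s

  -- Times up to `z′` are early, `suc t` with `z′ ≤ t ≤ z` stands for the old time `t`, and later
  -- times are late.
  phase : ∀ s → Phase s
  phase s with s ≤? z′
  ... | yes s≤z′ = early earlyPhase
    where
    earlyPhase : ∀ x → shiftStart x ≤ s → x ≤ z′
    earlyPhase x ≤s with x ≤? z′
    ... | yes x≤z′ = x≤z′
    ... | no x≰z′  = contradiction
      (≤-trans (s≤s (⊓-glb (≰⇒≥ x≰z′) (m≤n⇒m≤1+n z′≤z))) (≤-trans ≤s s≤z′)) 1+n≰n
  phase zero | no s≰z′ = contradiction z≤n s≰z′
  phase (suc t) | no s≰z′ with t ≤? z
  ... | yes t≤z = middle t (s≤s⁻¹ (≰⇒> s≰z′)) t≤z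
                    (λ x y (≤s , s≤) → startPhase x ≤s , endPhase y s≤)
    where
    startPhase : ∀ x → shiftStart x ≤ suc t → x ≤ t
    startPhase x ≤s with x ≤? z′
    ... | yes x≤z′ = ≤-trans x≤z′ (s≤s⁻¹ (≰⇒> s≰z′))
    ... | no _ with x ≤? suc z
    ...   | yes x≤z = subst (_≤ t) (m≤n⇒m⊓n≡m x≤z) (s≤s⁻¹ ≤s)
    ...   | no x≰z  = contradiction
              (≤-trans (subst (_≤ t) (m≥n⇒m⊓n≡n (≰⇒≥ x≰z)) (s≤s⁻¹ ≤s)) t≤z) 1+n≰n
    endPhase : ∀ y → suc t ≤ shiftEnd y → t ≤ y
    endPhase y s≤ with z ≤? y | z′ ≤? y
    ... | yes z≤y | _     = ≤-trans t≤z z≤y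
    ... | no _    | yes _ = s≤s⁻¹ s≤
    ... | no _    | no _  = contradiction s≤ s≰z′
  ... | no t≰z = late latePhase
    where
    latePhase : ∀ y → suc t ≤ shiftEnd y → z ≤ y
    latePhase y s≤ with z ≤? y | z′ ≤? y
    ... | yes z≤y | _     = z≤y
    ... | no z≰y  | yes _ = contradiction (≤-trans (s≤s⁻¹ s≤) (≰⇒≥ z≰y)) t≰z
    ... | no _    | no _  = contradiction s≤ s≰z′

-- Outside [z′ , z] the sets {start ≤ t ≤ end} need not be colourable; only the
-- two extreme bags {start ≤ z′} and {z ≤ end} are.
truncate : ∀ H c (start end : Vertex H → ℕ) →
  (∀ {u w} → Adj H u w → start u ≤ end w) → ∀ {z′ z} → z′ ≤ z →
  ColourableOn H c (λ u → start u ≤ z′) →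
  (∀ t → z′ ≤ t → t ≤ z → ColourableOn H c (λ u → start u ≤ t × t ≤ end u)) →
  ColourableOn H c (λ u → z ≤ end u) → WeakModel H c
truncate H c start end start≤end z′≤z C-early C-middle C-late = record
  { lo         = shiftStart z′≤z ∘ start
  ; hi         = shiftEnd z′≤z ∘ end
  ; meet       = λ u~w → shift-mono z′≤z (start≤end u~w)
  ; colourable = bagColourable
  }
  where
  bagColourable : ∀ s → ColourableOn H c
    (λ u → shiftStart z′≤z (start u) ≤ s × s ≤ shiftEnd z′≤z (end u))
  bagColourable s with phase z′≤z s
  ... | early cut = restrict (λ u (≤s , _) → cut (start u) ≤s) C-early
  ... | middle t z′≤t t≤z cut = restrict (λ u → cut (start u) (end u)) (C-middle t z′≤t t≤z)
  ... | late cut = restrict (λ u (_ , s≤) → cut (end u) s≤) C-late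

-- The two cases of the dichotomy

module Dichotomy (H : Graph) (k₁ ℓ : ℕ) (M : IntervalModel (R (suc ℓ) H) (suc k₁))
  (split : RowSplit (3 + k₁) (3 + k₁) (2 + k₁) (suc ℓ)
             (λ x → IntervalModel.lo M (x , nothing)) (λ x → IntervalModel.hi M (x , nothing)))
  where
  k = suc k₁
  open Rows H k (suc ℓ) M
  open RowSplit split

  z z′ : ℕ
  z  = r i
  z′ = l j

  module Separated (z<z′ : z < z′) where
    S : Vertex H → Set
    S u = (∀ a → Covers z (α a) u) ⊎ (∀ b → Covers z (β b) u)

    S? : Decidable S
    S? u = all? (λ a → Covers? z (α a) u) ⊎-dec all? (λ b → Covers? z (β b) u)

    z≤β : ∀ b u → z ≤ hi (β b) u
    z≤β b u = ≤-trans (<⇒≤ z<z′) (≤-trans (z′≤β b) (l≤hi (β b) u))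

    -- The centre of `α a` ends by `z`, so every vertex of that row has started by `z` and can miss
    -- `z` only by ending early. `starts` is the mirror image for `β`.
    ends : ∀ {u} → ¬ S u → ∃[ a ] hi (α a) u < z
    ends {u} ¬Su with ¬∀⟶∃¬ _ (λ a → Covers z (α a) u) (λ a → Covers? z (α a) u) (¬Su ∘ inj₁)
    ... | a , ¬cov = a , ≰⇒> λ z≤hi → ¬cov (≤-trans (lo≤r (α a) u) (α≤z a) , z≤hi)

    starts : ∀ {u} → ¬ S u → ∃[ b ] z < lo (β b) u
    starts {u} ¬Su with ¬∀⟶∃¬ _ (λ b → Covers z (β b) u) (λ b → Covers? z (β b) u) (¬Su ∘ inj₂)
    ... | b , ¬cov = b , ≰⇒> λ lo≤z → ¬cov (lo≤z , z≤β b u)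

    S-robust : ∀ u → S u → ∃ (RobustColour z u)
    -- All rows cover `u`, so the excepted row `i` is a dummy.
    S-robust u (inj₁ cov) = robust α α-inj i (λ a _ → cov a)
    S-robust u (inj₂ cov) = robust β β-inj i (λ b _ → cov b)

    z∋i : CoversCentre z i
    z∋i = l≤r i , ≤-refl

    -- Otherwise a copy of `w` ending before `z` would have to meet a copy of `u`, in another row,
    -- starting after `z`.
    indep : ∀ u w → ¬ S u → ¬ S w → ¬ Adj H u w
    indep u w ¬Su ¬Sw u~w with ends ¬Sw | starts ¬Su
    ... | a , hi<z | b , z<lo =
      <⇒≱ (<-trans hi<z z<lo) (lo≤hi (α≢β a _ ∘ sym) u~w)

    -- The copy of `w` in row `i` meets a copy of `u` that ends before `z` and one that starts after
    -- `z`.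
    i-covers : ∀ u w → ¬ S u → Adj H u w → Covers z i w
    i-covers u w ¬Su u~w with ends ¬Su | starts ¬Su
    ... | a , hi<z | b , z<lo =
      ≤-trans (lo≤hi (i≢α a) (Graph.~-sym H u~w)) (<⇒≤ hi<z) ,
      ≤-trans (<⇒≤ z<lo) (lo≤hi (i≢β _ ∘ sym) u~w)

    colourH : ColourableOn H k (λ _ → ⊤)
    colourH = restrict (λ u _ → inOrOut u)
      (addColour (λ u → ¬? (S? u)) (proj₁ avoiding) (centre<k z∋i) indep
        (λ u w ¬Su Sw u~w → proj₂ avoiding w Sw (i-covers u w ¬Su u~w , z∋i , refl)))
      where
      avoiding = avoidCentre z (centre z i) S? S-robust (const i)
      inOrOut : ∀ u → S u ⊎ ¬ S u
      inOrOut u with S? u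
      ... | yes Su = inj₁ Su
      ... | no ¬Su = inj₂ ¬Su

  module Overlapping (z′≤z : z′ ≤ z) where
    -- Intervals of adjacent vertices need not meet within a row. Hence a vertex
    -- starts when all rows but one have started, but ends with the first row;
    -- row j is never the excepted one, so that it is present at time z′.
    Ends : Vertex H → ℕ → Set
    Ends u t = ∃[ p ] (p ≢ j × hi p u ≤ t)

    Started : Vertex H → ℕ → Set
    Started u t = ∃[ p ] (p ≢ j × ∀ q → q ≢ p → lo q u ≤ t)

    leastEnd : ∀ u → ∃ (IsMinimum (Ends u))
    leastEnd u = least (λ t → any? λ p → ¬? (p ≟ j) ×-dec (hi p u ≤? t))
                       (hi i u) (i , i≢j , ≤-refl)

    end : Vertex H → ℕ
    end u = proj₁ (leastEnd u)

    ≤end : ∀ {u t} → t ≤ end u → ∀ p → p ≢ j → t ≤ hi p u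
    ≤end {u} t≤ p p≢j = ≤-trans t≤ (proj₂ (proj₂ (leastEnd u)) _ (p , p≢j , ≤-refl))

    -- The row `p` attaining `end w` is the exceptional row for `u`: in every other row `u` meets
    -- that copy of `w`.
    started-end : ∀ {u w} → Adj H u w → Started u (end w)
    started-end {u} {w} u~w with proj₁ (proj₂ (leastEnd w))
    ... | p , p≢j , hi≤ = p , p≢j , λ q q≢p → ≤-trans (lo≤hi q≢p u~w) hi≤

    upper : ∀ u → ∃[ b ] ∀ q → lo q u ≤ b
    upper u with argmin {ℓ} {λ p q → lo q u ≤ lo p u} (λ _ _ → ≤-total _ _) (flip ≤-trans)
    ... | p , max = lo p u , max

    leastStart : ∀ u → ∃ (IsMinimum (Started u))
    leastStart u = least
      (λ t → any? λ p → ¬? (p ≟ j) ×-dec all? λ q → ¬? (q ≟ p) →-dec (lo q u ≤? t))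
      (proj₁ (upper u))
      (i , i≢j , λ q _ → proj₂ (upper u) q)

    start : Vertex H → ℕ
    start u = proj₁ (leastStart u)

    start≤ : ∀ {u t} → start u ≤ t → Started u t
    start≤ {u} ≤t with proj₁ (proj₂ (leastStart u))
    ... | p , p≢j , lo≤ = p , p≢j , λ q q≢p → ≤-trans (lo≤ q q≢p) ≤t

    start≤end : ∀ {u w} → Adj H u w → start u ≤ end w
    start≤end {u} u~w = proj₂ (proj₂ (leastStart u)) _ (started-end u~w)

    reduce : ∀ t {c} {S : Vertex H → Set} → Decidable S → c < k →
      (∀ u → S u → ∃ (RobustColour t u)) → (row : Vertex H → Fin (suc ℓ)) →
      (∀ u → S u → Alternative t c u (row u)) → ColourableOn H k₁ S
    reduce t {c} S? c<k rob row alt with avoidCentre t c S? rob row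
    ... | C , avoids = dropColour C c<k (λ u Su → avoids u Su (alt u Su))

    -- At time `z` row `i` supplies all alternatives, its centre being present for the last time.
    lateColourable : ColourableOn H k₁ (λ u → z ≤ end u)
    lateColourable = reduce z (λ u → z ≤? end u) (centre<k z∋i)
      (λ u z≤ → robust α α-inj j (λ a a≢j → ≤-trans (lo≤r (α a) u) (α≤z a) , ≤end z≤ (α a) a≢j))
      (const i)
      (λ u z≤ → (lo≤r i u , ≤end z≤ i i≢j) , z∋i , refl)
      where
      z∋i : CoversCentre z i
      z∋i = l≤r i , ≤-refl

    -- At time `z′` the copies of `u` in `β` have not ended, and all but at most one have started.
    -- Row `j` supplies the alternatives.
    earlyColourable : ColourableOn H k₁ (λ u → start u ≤ z′)
    earlyColourable = reduce z′ (λ u → start u ≤? z′) (centre<k z′∋j)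
      (λ u s → let p , _ , lo≤ = start≤ s in
         robust β β-inj p (λ b b≢p → lo≤ (β b) b≢p , ≤-trans (z′≤β b) (l≤hi (β b) u)))
      (const j)
      (λ u s → let p , p≢j , lo≤ = start≤ s in
         (lo≤ j (p≢j ∘ sym) , l≤hi j u) , z′∋j , refl)
      where
      z′∋j : CoversCentre z′ j
      z′∋j = ≤-refl , l≤r j

    middleColourable : ∀ t → z′ ≤ t → t ≤ z →
      ColourableOn H k₁ (λ u → start u ≤ t × t ≤ end u)
    middleColourable t z′≤t t≤z =
      reduce t (λ u → (start u ≤? t) ×-dec (t ≤? end u)) (centre<k (t∋γ a))
        (λ u (s , t≤) → let p , _ , lo≤ = start≤ s in
           robust α α-inj p (λ a a≢p → lo≤ (α a) a≢p , ≤end t≤ (α a) (α≢j a)))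
        row row-alternative
      where
      t∋γ : ∀ q → CoversCentre t (γ q)
      t∋γ q = ≤-trans (γ≤z′ q) z′≤t , ≤-trans t≤z (z≤γ q)
      -- One row `γ a` could be the exceptional row of some `u`; a second row whose centre has the
      -- same colour then takes over.
      twin = pigeonhole< (n<1+n k) (λ q → centre t (γ q)) (λ q → centre<k (t∋γ q))
      a = proj₁ twin
      b = proj₁ (proj₂ twin)
      a≢b = proj₁ (proj₂ (proj₂ twin))
      ca≡cb = proj₂ (proj₂ (proj₂ twin))
      one-covers : ∀ u → start u ≤ t × t ≤ end u → Covers t (γ a) u ⊎ Covers t (γ b) u
      one-covers u (s , t≤) = let p , _ , lo≤ = start≤ s in case γ a ≟ p of λ where
        (no γa≢p)  → inj₁ (lo≤ (γ a) γa≢p , ≤end t≤ (γ a) (γ≢j a))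
        (yes γa≡p) → inj₂ (lo≤ (γ b) (λ γb≡p → a≢b (γ-inj (trans γa≡p (sym γb≡p)))) ,
                           ≤end t≤ (γ b) (γ≢j b))
      row : Vertex H → Fin (suc ℓ)
      row u with Covers? t (γ a) u
      ... | yes _ = γ a
      ... | no  _ = γ b
      row-alternative : ∀ u → start u ≤ t × t ≤ end u → Alternative t (centre t (γ a)) u (row u)
      row-alternative u present with Covers? t (γ a) u
      ... | yes cov = cov , t∋γ a , refl
      ... | no ¬cov = [ flip contradiction ¬cov , (λ cov → cov , t∋γ b , sym ca≡cb) ]′
                        (one-covers u present)

    weakModel : WeakModel H k₁
    weakModel = truncate H k₁ start end start≤end z′≤z
                  earlyColourable middleColourable lateColourable

  colourable⊎weakModel : ColourableOn H k (λ _ → ⊤) ⊎ WeakModel H k₁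
  colourable⊎weakModel with <-≤-connex z z′
  ... | inj₁ z<z′ = inj₁ (Separated.colourH z<z′)
  ... | inj₂ z′≤z = inj₂ (Overlapping.weakModel z′≤z)

dichotomy : ∀ {H k₁} → IntervalModel (R (rowCount (suc k₁)) H) (suc k₁) →
  ColourableOn H (suc k₁) (λ _ → ⊤) ⊎ WeakModel H k₁
dichotomy {H} {k₁} M = Dichotomy.colourable⊎weakModel H k₁ _ M (splitRows (3 + k₁) (3 + k₁) (2 + k₁) _ _)

-- From R m G to G

-- Greedy choice: there are always two more free rows than elements left, hence at least three when
-- a choice is due.
distinctRepresentatives : ∀ n (Good : Fin n → Fin (2 + n) → Set) →
  (∀ v {a b c} → a ≢ b → b ≢ c → a ≢ c → Good v a ⊎ Good v b ⊎ Good v c) →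
  Σ[ σ ∈ (Fin n → Fin (2 + n)) ] (Injective _≡_ _≡_ σ × ∀ v → Good v (σ v))
distinctRepresentatives zero Good three = (λ ()) , (λ { {()} }) , λ ()
distinctRepresentatives (suc n) Good three =
  consPunchIn x σ , consPunchIn-injective x σ-inj , λ { zero → x-good ; (suc v) → σ-good v }
  where
  first : ∃ (Good zero)
  first with three zero {zero} {suc zero} {suc (suc zero)} (λ ()) (λ ()) (λ ())
  ... | inj₁ g        = _ , g
  ... | inj₂ (inj₁ g) = _ , g
  ... | inj₂ (inj₂ g) = _ , g
  x = proj₁ first
  x-good = proj₂ first
  others = distinctRepresentatives n (λ v y → Good (suc v) (punchIn x y))
    (λ v a≢b b≢c a≢c → three (suc v) (a≢b ∘ Fin.punchIn-injective x _ _)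
                         (b≢c ∘ Fin.punchIn-injective x _ _) (a≢c ∘ Fin.punchIn-injective x _ _))
  σ = proj₁ others
  σ-inj = proj₁ (proj₂ others)
  σ-good = proj₂ (proj₂ others)

record Finite (V : Set) (n : ℕ) : Set where
  field
    index       : V → Fin n
    element     : Fin n → V
    element-index : ∀ v → element (index v) ≡ v

  index-injective : ∀ {u v} → index u ≡ index v → u ≡ v
  index-injective eq =
    trans (sym (element-index _)) (trans (cong element eq) (element-index _))

module _ (G : Graph) (n k : ℕ) (V-finite : Finite (Vertex G) n) where
  open Finite V-finite

  -- Distinct rows for the vertices give a copy of `G`. The last row stays free and offers
  -- replacements for the colour of its centre, which is then dropped.
  lowerColouring : ColourableOn (R (suc n) G) (suc k) (λ _ → ⊤) → ColourableOn G k (λ _ → ⊤)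
  lowerColouring C = dropColour (proj₁ avoiding) (bound C _ tt)
    (λ u _ → proj₂ avoiding u tt tt)
    where
    row : Vertex G → Fin (suc n)
    row v = inject₁ (index v)
    last≢row : ∀ v → fromℕ n ≢ row v
    last≢row v = Fin.fromℕ≢inject₁
    avoiding = recolour {D = λ _ → ⊤} (λ _ → yes tt) (colour C (fromℕ n , nothing))
      (record
        { colour = λ v → colour C (row v , just v)
        ; bound  = λ _ _ → bound C _ tt
        ; proper = λ u w _ _ u~w → proper C _ _ tt tt (inj₂
            ((λ eq → Graph.~-irrefl G
                (subst (Adj G u) (sym (index-injective (Fin.inject₁-injective eq))) u~w)) , u~w))
        })
      (λ v → colour C (fromℕ n , just v))
      (λ _ _ _ → bound C _ tt)
      (λ _ _ _ → proper C _ _ tt tt (inj₁ (refl , tt)))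
      (λ u w _ _ _ u~w → proper C _ _ tt tt (inj₂ (last≢row w , u~w)))

-- Filling empty intervals

module Fill (G : Graph) (n c : ℕ) (V-finite : Finite (Vertex G) n)
            (W : WeakModel (R (2 + n) G) c) where
  open Finite V-finite
  open WeakModel W using (meet; colourable)

  lo hi : Fin (2 + n) → Vertex G → ℕ
  lo i v = WeakModel.lo W (i , just v)
  hi i v = WeakModel.hi W (i , just v)

  -- Copies of `v` and of a neighbour within row `i` are not adjacent, so the neighbour's presence
  -- there must be forced by copies of `v` in other rows.
  Middle : Vertex G → Fin (2 + n) → Set
  Middle v i = (∃[ p ] (p ≢ i × hi p v ≤ hi i v)) × (∃[ q ] (q ≢ i × hi i v ≤ lo q v))

  Good : Vertex G → Fin (2 + n) → Set
  Good v i = lo i v ≤ hi i v ⊎ Middle v i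

  median : ∀ {v a b c} → a ≢ b → c ≢ b →
    hi a v ≤ hi b v → hi b v ≤ hi c v → hi c v < lo c v → Middle v b
  median {a = a} {c = c} a≢b c≢b a≤b b≤c c<c =
    (a , a≢b , a≤b) , (c , c≢b , ≤-trans b≤c (<⇒≤ c<c))

  -- If all three intervals are empty, the row with the median end is good: the row with the largest
  -- end starts later still.
  three : ∀ v {a b c} → a ≢ b → b ≢ c → a ≢ c → Good v a ⊎ Good v b ⊎ Good v c
  three v {a} {b} {c} a≢b b≢c a≢c with ≤-<-connex (lo a v) (hi a v)
    | ≤-<-connex (lo b v) (hi b v) | ≤-<-connex (lo c v) (hi c v)
  ... | inj₁ a-ok | _         | _         = inj₁ (inj₁ a-ok)
  ... | _         | inj₁ b-ok | _         = inj₂ (inj₁ (inj₁ b-ok))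
  ... | _         | _         | inj₁ c-ok = inj₂ (inj₂ (inj₁ c-ok))
  ... | inj₂ a<   | inj₂ b<   | inj₂ c<
    with ≤-total (hi a v) (hi b v) | ≤-total (hi b v) (hi c v) | ≤-total (hi a v) (hi c v)
  ... | inj₁ a≤b | inj₁ b≤c | _        = inj₂ (inj₁ (inj₂ (median a≢b (≢-sym b≢c) a≤b b≤c c<)))
  ... | inj₂ b≤a | inj₂ c≤b | _        = inj₂ (inj₁ (inj₂ (median (≢-sym b≢c) a≢b c≤b b≤a a<)))
  ... | inj₁ a≤b | inj₂ c≤b | inj₁ a≤c = inj₂ (inj₂ (inj₂ (median a≢c b≢c a≤c c≤b b<)))
  ... | inj₁ a≤b | inj₂ c≤b | inj₂ c≤a = inj₁ (inj₂ (median (≢-sym a≢c) (≢-sym a≢b) c≤a a≤b b<))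
  ... | inj₂ b≤a | inj₁ b≤c | inj₁ a≤c = inj₁ (inj₂ (median (≢-sym a≢b) (≢-sym a≢c) b≤a a≤c c<))
  ... | inj₂ b≤a | inj₁ b≤c | inj₂ c≤a = inj₂ (inj₂ (inj₂ (median b≢c a≢c b≤c c≤a a<)))

  representatives = distinctRepresentatives n (λ x → Good (element x)) (λ x → three (element x))

  row : Vertex G → Fin (2 + n)
  row v = proj₁ representatives (index v)

  row-injective : ∀ {u v} → row u ≡ row v → u ≡ v
  row-injective eq = index-injective (proj₁ (proj₂ representatives) eq)

  row-good : ∀ v → Good v (row v)
  row-good v = subst (λ u → Good u (row v)) (element-index v)
                 (proj₂ (proj₂ representatives) (index v))

  row≢ : ∀ {u v} → Adj G u v → row u ≢ row v
  row≢ u~v eq = Graph.~-irrefl G (subst (Adj G _) (sym (row-injective eq)) u~v)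

  Empty : Vertex G → Set
  Empty v = hi (row v) v < lo (row v) v

  -- Time t is split into the times t * N , … , t * N + n. A representative with
  -- an empty interval is put into one bag of its own among them.
  N : ℕ
  N = suc n

  private-time : Vertex G → ℕ
  private-time v = toℕ (index v) + hi (row v) v * N

  start end : Vertex G → ℕ
  start v with <-≤-connex (hi (row v) v) (lo (row v) v)
  ... | inj₁ _ = private-time v
  ... | inj₂ _ = lo (row v) v * N
  end v with <-≤-connex (hi (row v) v) (lo (row v) v)
  ... | inj₁ _ = private-time v
  ... | inj₂ _ = n + hi (row v) v * N

  private≤ : ∀ v → private-time v ≤ n + hi (row v) v * N
  private≤ v = +-monoˡ-≤ _ (<⇒≤ (Fin.toℕ<n (index v)))

  start≤end-self : ∀ v → start v ≤ end v
  start≤end-self v with <-≤-connex (hi (row v) v) (lo (row v) v)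
  ... | inj₁ _ = ≤-refl
  ... | inj₂ lo≤hi = ≤-trans (*-monoˡ-≤ N lo≤hi) (m≤n+m _ n)

  lo≤hi-row : ∀ {u v} → Adj G u v → lo (row u) u ≤ hi (row v) v
  lo≤hi-row u~v = meet (inj₂ (row≢ u~v , u~v))

  -- Adjacent representatives cannot both be empty, as each starts by the end of the other. A
  -- private time lies in the block of the old end, so the old inequalities carry over.
  start≤end : ∀ {u v} → Adj G u v → start u ≤ end v
  start≤end {u} {v} u~v with <-≤-connex (hi (row u) u) (lo (row u) u)
    | <-≤-connex (hi (row v) v) (lo (row v) v)
  ... | inj₁ u< | inj₁ v< = contradiction
    (<-trans v< (<-≤-trans (≤-<-trans (lo≤hi-row (Graph.~-sym G u~v)) u<) (lo≤hi-row u~v)))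
    (<-irrefl refl)
  ... | inj₁ u< | inj₂ _ = ≤-trans (private≤ u)
    (+-monoʳ-≤ n (*-monoˡ-≤ N (≤-trans (<⇒≤ u<) (lo≤hi-row u~v))))
  ... | inj₂ _ | inj₁ v< = ≤-trans (*-monoˡ-≤ N (lo≤hi-row u~v)) (m≤n+m _ _)
  ... | inj₂ _ | inj₂ _  = ≤-trans (*-monoˡ-≤ N (lo≤hi-row u~v)) (m≤n+m _ n)

  quotient≤ : ∀ {s t} → s ≤ n + t * N → s / N ≤ t
  quotient≤ s≤ = s≤s⁻¹ (m<n*o⇒m/o<n (s≤s s≤))

  ≤quotient : ∀ {s t} → t * N ≤ s → t ≤ s / N
  ≤quotient {s} {t} ≤s = subst (_≤ s / N) (m*n/n≡m t N) (/-monoˡ-≤ N ≤s)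

  Present : ℕ → Vertex G → Set
  Present t v = lo (row v) v ≤ t × t ≤ hi (row v) v

  Private : ℕ → Vertex G → Set
  Private s v = Empty v × private-time v ≡ s

  Private? : ∀ s v → Dec (Private s v)
  Private? s v = (hi (row v) v <? lo (row v) v) ×-dec (private-time v ℕ.≟ s)

  private-quotient : ∀ {s v} → Private s v → s / N ≡ hi (row v) v
  private-quotient {v = v} (_ , refl) =
    ≤-antisym (quotient≤ (private≤ v)) (≤quotient {t = hi (row v) v} (m≤n+m _ (toℕ (index v))))

  -- Division by `N` recovers the old end, and the remainder recovers the index.
  private-unique : ∀ {s u v} → Private s u → Private s v → u ≡ v
  private-unique {s} {u} {v} Pu@(_ , u≡s) Pv@(_ , v≡s) = index-injective (Fin.toℕ-injective
    (+-cancelʳ-≡ (hi (row v) v * N) (toℕ (index u)) (toℕ (index v))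
      (trans (cong (λ h → toℕ (index u) + h * N) (trans (sym (private-quotient Pv)) (private-quotient Pu)))
        (trans u≡s (sym v≡s)))))

  classify : ∀ {s} v → start v ≤ s × s ≤ end v → Present (s / N) v ⊎ Private s v
  classify v b with <-≤-connex (hi (row v) v) (lo (row v) v)
  classify v (≤s , s≤) | inj₁ v< = inj₂ (v< , ≤-antisym ≤s s≤)
  classify v (≤s , s≤) | inj₂ _  = inj₁ (≤quotient ≤s , quotient≤ s≤)

  presentColouring : ∀ t → ColourableOn G c (Present t)
  presentColouring t = record
    { colour = λ v → colour (colourable t) (row v , just v)
    ; bound  = λ v → bound (colourable t) _
    ; proper = λ u v pu pv u~v → proper (colourable t) _ _ pu pv (inj₂ (row≢ u~v , u~v))
    }

  -- The intervals of all neighbours of an empty interval contain [hi , lo].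
  module WithPrivate (v : Vertex G) (v-empty : Empty v) where
    t : ℕ
    t = hi (row v) v

    g : Fin (2 + n) × Maybe (Vertex G) → ℕ
    g = colour (colourable t)

    centre-present : WeakModel.lo W (row v , nothing) ≤ t × t ≤ WeakModel.hi W (row v , nothing)
    centre-present = meet (inj₁ (refl , tt)) , ≤-trans (<⇒≤ v-empty) (meet (inj₁ (refl , tt)))

    neighbour-present : ∀ u → Adj G v u → lo (row v) u ≤ t × t ≤ hi (row v) u
    neighbour-present u v~u with row-good v
    ... | inj₁ lo≤hi = contradiction lo≤hi (<⇒≱ v-empty)
    ... | inj₂ ((p , p≢ , hi≤) , (q , q≢ , ≤lo)) =
      ≤-trans (meet (inj₂ (≢-sym p≢ , Graph.~-sym G v~u))) hi≤ ,
      ≤-trans ≤lo (meet (inj₂ (q≢ , v~u)))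

    -- Neighbours of `v` leave the colour of the centre of `row v` for their colours in that row.
    -- Since `v` is absent at time `t`, no present vertex is represented there, so nothing
    -- conflicts, and `v` takes the freed colour.
    extended : ColourableOn G c (λ u → Present t u ⊎ index u ≡ index v)
    extended = addColour (λ u → index u ≟ index v) (proj₁ avoiding)
      (bound (colourable t) _ centre-present)
      (λ u w u≡v w≡v u~w → Graph.~-irrefl G
        (subst (Adj G u) (index-injective (trans w≡v (sym u≡v))) u~w))
      (λ u w u≡v pw u~w → proj₂ avoiding w pw
        (subst (λ x → Adj G x w) (index-injective u≡v) u~w))
      where
      row-v≢ : ∀ w → Present t w → row v ≢ row w
      row-v≢ w (lo≤ , ≤hi) eq with row-injective eq
      ... | refl = <⇒≱ v-empty lo≤
      avoiding = recolour {D = Adj G v} (Graph._~?_ G v) (g (row v , nothing)) (presentColouring t)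
        (λ u → g (row v , just u))
        (λ u _ v~u → bound (colourable t) _ (neighbour-present u v~u))
        (λ u _ v~u → proper (colourable t) _ _ (neighbour-present u v~u) centre-present
                       (inj₁ (refl , tt)))
        (λ u w _ v~u pw u~w → proper (colourable t) _ _ (neighbour-present u v~u) pw
                                (inj₂ (row-v≢ w pw , u~w)))

  intervalModel : IntervalModel G c
  intervalModel = record
    { weakModel = record
      { lo = start ; hi = end ; meet = start≤end ; colourable = bagColourable }
    ; lo≤hi = start≤end-self
    }
    where
    bagColourable : ∀ s → ColourableOn G c (λ v → start v ≤ s × s ≤ end v)
    bagColourable s with any? (λ x → Private? s (element x))
    ... | no none = restrict present (presentColouring (s / N))
      where
      present : ∀ v → start v ≤ s × s ≤ end v → Present (s / N) v
      present v b with classify v b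
      ... | inj₁ p = p
      ... | inj₂ q = contradiction (index v , subst (Private s) (sym (element-index v)) q) none
    ... | yes (x , q) = restrict present (WithPrivate.extended (element x) (proj₁ q))
      where
      present : ∀ v → start v ≤ s × s ≤ end v →
        Present (hi (row (element x)) (element x)) v ⊎ index v ≡ index (element x)
      present v b with classify v b
      ... | inj₁ p = inj₁ (subst (λ t → Present t v) (private-quotient q) p)
      ... | inj₂ q′ = inj₂ (cong index (private-unique q′ q))

-- Path-decompositions and interval models of finite graphs

weaken : ∀ {G c c′ S} → c ≤ c′ → ColourableOn G c S → ColourableOn G c′ S
weaken c≤c′ C = record
  { colour = colour C
  ; bound  = λ v Sv → <-≤-trans (bound C v Sv) c≤c′
  ; proper = proper C
  }

-- `finToFun` recovers a function only pointwise, so `P` must respect pointwise equality.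
anyFunction? : ∀ {m n} {P : (Fin m → Fin n) → Set} →
  (∀ {f g} → (∀ x → f x ≡ g x) → P f → P g) → Decidable P → Dec (∃ P)
anyFunction? resp P? = map′
  (λ (x , p) → finToFun x , p)
  (λ (f , p) → funToFin f , resp (λ x → sym (Fin.finToFun-funToFin f x)) p)
  (any? (P? ∘ finToFun))

module FiniteGraph (G : Graph) (n : ℕ) (V-finite : Finite (Vertex G) n) where
  open Finite V-finite

  allVertices? : {P : Vertex G → Set} → Decidable P → Dec (∀ v → P v)
  allVertices? {P} P? = map′
    (λ all v → subst P (element-index v) (all (index v)))
    (λ all x → all (element x))
    (all? (P? ∘ element))

  IsColouring : (Vertex G → Set) → ℕ → (Vertex G → ℕ) → Set
  IsColouring S c f = (∀ v → S v → f v < c) × ProperOn G S f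

  IsColouring-resp : ∀ {S c f g} → (∀ v → S v → f v ≡ g v) → IsColouring S c f → IsColouring S c g
  IsColouring-resp f≗g (f<c , f-proper) =
    (λ v Sv → subst (_< _) (f≗g v Sv) (f<c v Sv)) ,
    (λ u w Su Sw u~w → subst₂ _≢_ (f≗g u Su) (f≗g w Sw) (f-proper u w Su Sw u~w))

  -- The search is over `Fin (suc c)`, as vertices outside `S` need some colour even when `c` is
  -- zero.
  colourableOn? : {S : Vertex G → Set} → Decidable S → ∀ c → Dec (ColourableOn G c S)
  colourableOn? {S} S? c = map′
    (λ (f , f<c , f-proper) → colouring (extend f) f<c f-proper)
    (λ C → clamp C , IsColouring-resp (clamp-colour C) (bound C , proper C))
    (anyFunction? (λ f≗g → IsColouring-resp (λ v _ → cong toℕ (f≗g (index v)))) isColouring?)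
    where
    extend : (Fin n → Fin (suc c)) → Vertex G → ℕ
    extend f v = toℕ (f (index v))
    isColouring? : Decidable (λ f → IsColouring S c (extend f))
    isColouring? f =
      allVertices? (λ v → S? v →-dec (extend f v <? c)) ×-dec
      allVertices? (λ u → allVertices? (λ w → S? u →-dec (S? w →-dec
        (Graph._~?_ G u w →-dec ¬? (extend f u ℕ.≟ extend f w)))))
    clamp : ColourableOn G c S → Fin n → Fin (suc c)
    clamp C x = fromℕ< (s≤s (m⊓n≤n (colour C (element x)) c))
    clamp-colour : ∀ C v → S v → colour C v ≡ extend (clamp C) v
    clamp-colour C v Sv = begin
      colour C v                       ≡⟨ m≤n⇒m⊓n≡m (<⇒≤ (bound C v Sv)) ⟨
      colour C v ⊓ c                   ≡⟨ cong (λ u → colour C u ⊓ c) (element-index v) ⟨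
      colour C (element (index v)) ⊓ c ≡⟨ Fin.toℕ-fromℕ< _ ⟨
      extend (clamp C) v               ∎
      where open ≡-Reasoning

  injectiveColouring : ∀ {S} → ColourableOn G n S
  injectiveColouring = record
    { colour = toℕ ∘ index
    ; bound  = λ v _ → Fin.toℕ<n (index v)
    ; proper = λ u w _ _ u~w eq → Graph.~-irrefl G
        (subst (Adj G u) (sym (index-injective (Fin.toℕ-injective eq))) u~w)
    }

  fromColouring : ∀ {B c} → Colouring (G [ B ]) c → ColourableOn G c (_∈ B)
  fromColouring {B} {c} (f , f-proper) = record
    { colour = proj₁ chosen
    ; bound  = λ v v∈B → let v∈B′ , eq = proj₂ chosen v v∈B in
                         subst (_< c) (sym eq) (Fin.toℕ<n (f (v , v∈B′)))
    ; proper = λ u w u∈B w∈B u~w eq →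
        let u∈B′ , equ = proj₂ chosen u u∈B
            w∈B′ , eqw = proj₂ chosen w w∈B
        in f-proper (u , u∈B′) (w , w∈B′) u~w (Fin.toℕ-injective (trans (sym equ) (trans eq eqw)))
    }
    where
    chosen = choose {Q = λ v x → Σ[ v∈B ∈ v ∈ B ] x ≡ toℕ (f (v , v∈B))}
               (λ v → T? (B v)) (λ v v∈B → _ , v∈B , refl)

  toColouring : ∀ {B c} → ColourableOn G c (_∈ B) → Colouring (G [ B ]) c
  toColouring C = (λ (v , v∈B) → fromℕ< (bound C v v∈B)) ,
    λ (u , u∈B) (w , w∈B) u~w eq →
      proper C u w u∈B w∈B u~w (Fin.fromℕ<-injective _ _ (bound C u u∈B) (bound C w w∈B) eq)

  chromaticNumber : ∀ B → ∃ (IsChromaticNumber (G [ B ]))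
  chromaticNumber B = least
    (λ c → map′ toColouring fromColouring (colourableOn? (λ v → T? (B v)) c))
    n (toColouring injectiveColouring)

  fromDecomposition : ∀ {c} (D : PathDecomposition G) →
    IsDecompositionChromaticNumber D c → IntervalModel G c
  fromDecomposition {c} D (_ , c-max) = record
    { weakModel = record
      { lo = toℕ ∘ lo ; hi = toℕ ∘ hi
      ; meet = λ {u} {w} u~w → let t , u∈ , w∈ = coversEdges u w u~w in
                               ≤-trans (lo-least u t u∈) (hi-greatest w t w∈)
      ; colourable = intervalColourable
      }
    ; lo≤hi = λ v → let t , v∈ = covers v in ≤-trans (lo-least v t v∈) (hi-greatest v t v∈)
    }
    where
    open PathDecomposition D
    first : ∀ v → ∃[ t ] (v ∈ bag t × ∀ s → v ∈ bag s → toℕ t ≤ toℕ s)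
    first v = argminOn (λ _ _ → ≤-total _ _) ≤-trans (λ t → T? (bag t v)) (covers v)
    last : ∀ v → ∃[ t ] (v ∈ bag t × ∀ s → v ∈ bag s → toℕ s ≤ toℕ t)
    last v = argminOn (λ _ _ → ≤-total _ _) (flip ≤-trans) (λ t → T? (bag t v)) (covers v)
    lo hi : Vertex G → Fin length
    lo v = proj₁ (first v)
    hi v = proj₁ (last v)
    lo-least : ∀ v s → v ∈ bag s → toℕ (lo v) ≤ toℕ s
    lo-least v = proj₂ (proj₂ (first v))
    hi-greatest : ∀ v s → v ∈ bag s → toℕ s ≤ toℕ (hi v)
    hi-greatest v = proj₂ (proj₂ (last v))
    between : ∀ v t → toℕ (lo v) ≤ toℕ t → toℕ t ≤ toℕ (hi v) → v ∈ bag t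
    between v t lo≤t t≤hi = consecutive v (lo v) t (hi v) lo≤t t≤hi
      (proj₁ (proj₂ (first v))) (proj₁ (proj₂ (last v)))
    bagColourable : ∀ t → ColourableOn G c (_∈ bag t)
    bagColourable t with chromaticNumber (bag t)
    ... | x , χ@(f , _) = weaken (c-max x (t , χ)) (fromColouring f)
    intervalColourable : ∀ t → ColourableOn G c (λ v → toℕ (lo v) ≤ t × t ≤ toℕ (hi v))
    intervalColourable t with t <? length
    ... | yes t<len = restrict (λ v (lo≤t , t≤hi) → between v (fromℕ< t<len)
            (subst (toℕ (lo v) ≤_) (sym (Fin.toℕ-fromℕ< t<len)) lo≤t)
            (subst (_≤ toℕ (hi v)) (sym (Fin.toℕ-fromℕ< t<len)) t≤hi))
            (bagColourable (fromℕ< t<len))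
    ... | no t≮len = record
            { colour = λ _ → 0
            ; bound  = λ v (_ , t≤hi) → contradiction (≤-<-trans t≤hi (Fin.toℕ<n (hi v))) t≮len
            ; proper = λ u _ (_ , t≤hi) → contradiction (≤-<-trans t≤hi (Fin.toℕ<n (hi u))) t≮len
            }

-- Compression of time and decidability

indicator : ∀ {P : Set} → Dec P → ℕ
indicator (yes _) = 1
indicator (no _)  = 0

rank : ∀ {n} → (Fin n → ℕ) → ℕ → ℕ
rank {zero}  h t = 0
rank {suc n} h t = indicator (h zero ≤? t) + rank (h ∘ suc) t

indicator-mono : ∀ x {s t} → s ≤ t → indicator (x ≤? s) ≤ indicator (x ≤? t)
indicator-mono x {s} {t} s≤t with x ≤? s | x ≤? t
... | yes _   | yes _  = ≤-refl
... | yes x≤s | no x≰t = contradiction (≤-trans x≤s s≤t) x≰t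
... | no _    | _      = z≤n

rank-mono : ∀ {n} (h : Fin n → ℕ) {s t} → s ≤ t → rank h s ≤ rank h t
rank-mono {zero}  h s≤t = z≤n
rank-mono {suc n} h s≤t = +-mono-≤ (indicator-mono (h zero) s≤t) (rank-mono (h ∘ suc) s≤t)

rank-mono-< : ∀ {n} (h : Fin n → ℕ) {s t} x → s < h x → h x ≤ t → rank h s < rank h t
rank-mono-< {suc n} h {s} {t} zero s<h h≤t with h zero ≤? s | h zero ≤? t
... | yes h≤s | _      = contradiction h≤s (<⇒≱ s<h)
... | no _    | no h≰t = contradiction h≤t h≰t
... | no _    | yes _  = s≤s (rank-mono (h ∘ suc) (<⇒≤ (<-≤-trans s<h h≤t)))
rank-mono-< {suc n} h (suc x) s<h h≤t =
  +-mono-≤-< (indicator-mono (h zero) (<⇒≤ (<-≤-trans s<h h≤t))) (rank-mono-< (h ∘ suc) x s<h h≤t)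

rank≤ : ∀ {n} (h : Fin n → ℕ) t → rank h t ≤ n
rank≤ {zero}  h t = z≤n
rank≤ {suc n} h t with h zero ≤? t
... | yes _ = s≤s (rank≤ (h ∘ suc) t)
... | no _  = m≤n⇒m≤1+n (rank≤ (h ∘ suc) t)

module FiniteGraphModels (G : Graph) (n : ℕ) (V-finite : Finite (Vertex G) n) where
  open Finite V-finite
  open FiniteGraph G n V-finite

  -- Every nonempty bag lies in the bag at some left end point, so times can be
  -- replaced by the number of intervals that have started.
  compress : ∀ {c} → IntervalModel G c →
    Σ[ M ∈ IntervalModel G c ] (∀ v → IntervalModel.hi M v ≤ n)
  compress {c} M = record
    { weakModel = record
      { lo = rank h ∘ lo ; hi = rank h ∘ hi
      ; meet = λ u~w → rank-mono h (meet u~w)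
      ; colourable = bagColourable
      }
    ; lo≤hi = λ v → rank-mono h (lo≤hi v)
    } , λ v → rank≤ h (hi v)
    where
    open IntervalModel M
    h : Fin n → ℕ
    h x = lo (element x)
    h-index : ∀ v → h (index v) ≡ lo v
    h-index v = cong lo (element-index v)
    bagColourable : ∀ s → ColourableOn G c (λ v → rank h (lo v) ≤ s × s ≤ rank h (hi v))
    bagColourable s with any? (λ x → rank h (h x) ≤? s)
    -- No interval has started, so the bag is empty and any colouring will do.
    ... | no none = restrict (λ v (lo≤s , _) → contradiction
            (index v , subst (λ t → rank h t ≤ s) (sym (h-index v)) lo≤s) none) (colourable 0)
    ... | yes some with argminOn {_≼_ = λ x y → h y ≤ h x} (λ _ _ → ≤-total _ _) (flip ≤-trans)
                          (λ x → rank h (h x) ≤? s) some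
    -- `h x` is the latest start of rank at most `s`; an end before it would have rank below `s`.
    ...   | x , rank≤s , max = restrict (λ v (lo≤s , s≤hi) →
              subst (_≤ h x) (h-index v)
                (max (index v) (subst (λ t → rank h t ≤ s) (sym (h-index v)) lo≤s)) ,
              ≮⇒≥ (λ hi<hx → <⇒≱ (rank-mono-< h x hi<hx ≤-refl) (≤-trans rank≤s s≤hi)))
            (colourable (h x))

  toDecomposition : ∀ {c} → IntervalModel G c →
    ∃[ c′ ] (c′ ≤ c × Σ[ D ∈ PathDecomposition G ] IsDecompositionChromaticNumber D c′)
  toDecomposition {c} M₀ = χ t* ,
    proj₂ (isχ t*) c (toColouring (restrict (λ v → toWitness) (colourable (toℕ t*)))) ,
    D , (t* , isχ t*) ,
    λ x (t , χx) → ≤-trans (proj₂ χx (χ t) (proj₁ (isχ t))) (max t)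
    where
    M = proj₁ (compress M₀)
    open IntervalModel M
    inBag? : ∀ (t : Fin (suc n)) v → Dec (lo v ≤ toℕ t × toℕ t ≤ hi v)
    inBag? t v = (lo v ≤? toℕ t) ×-dec (toℕ t ≤? hi v)
    time : ∀ {s v} → s ≤ hi v → Σ[ t ∈ Fin (suc n) ] toℕ t ≡ s
    time {s} {v} s≤hi = fromℕ< s<1+n , Fin.toℕ-fromℕ< s<1+n
      where
      s<1+n : s < suc n
      s<1+n = s≤s (≤-trans s≤hi (proj₂ (compress M₀) v))
    D : PathDecomposition G
    D = record
      { length      = suc n
      ; bag         = λ t v → ⌊ inBag? t v ⌋
      ; covers      = λ v → let t , eq = time {v = v} (lo≤hi v) in t , fromWitness
          (≤-reflexive (sym eq) , ≤-trans (≤-reflexive eq) (lo≤hi v))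
      ; coversEdges = λ u w u~w →
          -- Both ends of an edge are present at the later of their starts.
          let ⊔≤u = ⊔-lub (lo≤hi u) (meet (Graph.~-sym G u~w))
              ⊔≤w = ⊔-lub (meet u~w) (lo≤hi w)
              t , eq = time {v = u} ⊔≤u
          in t ,
             fromWitness (≤-trans (m≤m⊔n (lo u) (lo w)) (≤-reflexive (sym eq)) ,
                          ≤-trans (≤-reflexive eq) ⊔≤u) ,
             fromWitness (≤-trans (m≤n⊔m (lo u) (lo w)) (≤-reflexive (sym eq)) ,
                          ≤-trans (≤-reflexive eq) ⊔≤w)
      ; consecutive = λ v r s t r≤s s≤t v∈r v∈t → fromWitness
          (≤-trans (proj₁ (toWitness v∈r)) r≤s , ≤-trans s≤t (proj₂ (toWitness v∈t)))
      }
    χ : Fin (suc n) → ℕ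
    χ t = proj₁ (chromaticNumber (PathDecomposition.bag D t))
    isχ : ∀ t → IsChromaticNumber (G [ PathDecomposition.bag D t ]) (χ t)
    isχ t = proj₂ (chromaticNumber (PathDecomposition.bag D t))
    largest : ∃[ t ] ∀ s → χ s ≤ χ t
    largest = argmin (λ _ _ → ≤-total _ _) (flip ≤-trans)
    t* = proj₁ largest
    max = proj₂ largest

  IsModel : ℕ → (Vertex G → ℕ) → (Vertex G → ℕ) → Set
  IsModel c lo hi =
    (∀ v → lo v ≤ hi v) ×
    (∀ u w → Adj G u w → lo u ≤ hi w) ×
    (∀ (t : Fin (suc n)) → ColourableOn G c (λ v → lo v ≤ toℕ t × toℕ t ≤ hi v))

  IsModel-resp : ∀ {c lo lo′ hi hi′} → (∀ v → lo v ≡ lo′ v) → (∀ v → hi v ≡ hi′ v) →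
    IsModel c lo hi → IsModel c lo′ hi′
  IsModel-resp lo≗ hi≗ (lo≤hi , meet , col) =
    (λ v → subst₂ _≤_ (lo≗ v) (hi≗ v) (lo≤hi v)) ,
    (λ u w u~w → subst₂ _≤_ (lo≗ u) (hi≗ w) (meet u w u~w)) ,
    (λ t → restrict (λ v (lo≤t , t≤hi) →
       subst (_≤ toℕ t) (sym (lo≗ v)) lo≤t , subst (toℕ t ≤_) (sym (hi≗ v)) t≤hi) (col t))

  extend : (Fin n → Fin (suc n)) → Vertex G → ℕ
  extend f v = toℕ (f (index v))

  isModel? : ∀ c lo hi → Dec (IsModel c (extend lo) (extend hi))
  isModel? c lo hi =
    allVertices? (λ v → extend lo v ≤? extend hi v) ×-dec
    (allVertices? (λ u → allVertices? λ w → Graph._~?_ G u w →-dec (extend lo u ≤? extend hi w)) ×-dec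
     all? (λ t → colourableOn? (λ v → (extend lo v ≤? toℕ t) ×-dec (toℕ t ≤? extend hi v)) c))

  -- Compression bounds all end points by `n`, which makes the search finite. Decidability then
  -- yields a least model, hence the existence of the path-chromatic number.
  model? : ∀ c → Dec (IntervalModel G c)
  model? c = map′ fromSearch toSearch
    (anyFunction? (λ lo≗ (hi , m) → hi , IsModel-resp (cong toℕ ∘ lo≗ ∘ index) (λ _ → refl) m)
      (λ lo → anyFunction? (λ hi≗ → IsModel-resp (λ _ → refl) (cong toℕ ∘ hi≗ ∘ index))
        (isModel? c lo)))
    where
    fromSearch : (∃[ lo ] ∃[ hi ] IsModel c (extend lo) (extend hi)) → IntervalModel G c
    fromSearch (lo , hi , lo≤hi , meet , col) = record
      { weakModel = record
        { lo = extend lo ; hi = extend hi ; meet = meet _ _ ; colourable = bagColourable }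
      ; lo≤hi = lo≤hi
      }
      where
      bagColourable : ∀ t → ColourableOn G c (λ v → extend lo v ≤ t × t ≤ extend hi v)
      bagColourable t with t <? suc n
      ... | yes t<1+n = subst (λ s → ColourableOn G c (λ v → extend lo v ≤ s × s ≤ extend hi v))
                          (Fin.toℕ-fromℕ< t<1+n) (col (fromℕ< t<1+n))
      ... | no t≮1+n  = restrict (λ v (_ , t≤hi) → contradiction
                          (≤-<-trans t≤hi (Fin.toℕ<n (hi (index v)))) t≮1+n) (col zero)
    toSearch : IntervalModel G c → ∃[ lo ] ∃[ hi ] IsModel c (extend lo) (extend hi)
    toSearch M₀ = encode lo lo≤n , encode hi hi≤n ,
      IsModel-resp (encode-extend lo lo≤n) (encode-extend hi hi≤n)
        (lo≤hi , (λ u w → meet) , (λ t → colourable (toℕ t)))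
      where
      open IntervalModel (proj₁ (compress M₀))
      hi≤n : ∀ v → hi v ≤ n
      hi≤n = proj₂ (compress M₀)
      lo≤n : ∀ v → lo v ≤ n
      lo≤n v = ≤-trans (lo≤hi v) (hi≤n v)
      encode : (f : Vertex G → ℕ) → (∀ v → f v ≤ n) → Fin n → Fin (suc n)
      encode f f≤n x = fromℕ< (s≤s (f≤n (element x)))
      encode-extend : ∀ f f≤n v → f v ≡ extend (encode f f≤n) v
      encode-extend f f≤n v =
        trans (cong f (sym (element-index v))) (sym (Fin.toℕ-fromℕ< (s≤s (f≤n _))))

  oneBag : ∀ {c} → ColourableOn G c (λ _ → ⊤) → IntervalModel G c
  oneBag C = record
    { weakModel = record
      { lo = λ _ → 0 ; hi = λ _ → 0 ; meet = λ _ → z≤n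
      ; colourable = λ _ → restrict (λ _ _ → tt) C
      }
    ; lo≤hi = λ _ → z≤n
    }

  pathChromatic⇒least : ∀ {k} → IsPathChromaticNumber G k → ∀ j → IntervalModel G j → k ≤ j
  pathChromatic⇒least (_ , min) j M =
    let c , c≤j , Dχ = toDecomposition M in ≤-trans (min c Dχ) c≤j

  leastModel⇒pathChromatic : ∀ {k} → IsMinimum (IntervalModel G) k → IsPathChromaticNumber G k
  leastModel⇒pathChromatic {k} (M , min) =
    let c , c≤k , D , χ = toDecomposition M
    in subst (λ j → Σ[ D ∈ PathDecomposition G ] IsDecompositionChromaticNumber D j)
         (≤-antisym c≤k (min c (fromDecomposition D χ))) (D , χ) ,
       λ j (D′ , χ′) → min j (fromDecomposition D′ χ′)

  pathChromaticNumber : ∃ (IsMinimum (IntervalModel G))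
  pathChromaticNumber = least model? n (oneBag injectiveColouring)

-- Changing the parameters of R, and the final bounds

R-finite : ∀ {G n} m → Finite (Vertex G) n → Finite (Vertex (R m G)) (m * suc n)
R-finite {G} {n} m F = record { index = to ; element = from ; element-index = from-to }
  where
  open Finite F
  to : Fin m × Maybe (Vertex G) → Fin (m * suc n)
  to (i , nothing) = combine i zero
  to (i , just v)  = combine i (suc (index v))
  fromColumn : Fin (suc n) → Maybe (Vertex G)
  fromColumn zero    = nothing
  fromColumn (suc x) = just (element x)
  from : Fin (m * suc n) → Fin m × Maybe (Vertex G)
  from x = proj₁ (remQuot (suc n) x) , fromColumn (proj₂ (remQuot {m} (suc n) x))
  from-to : ∀ x → from (to x) ≡ x
  from-to (i , nothing) = cong (λ (j , y) → j , fromColumn y) (Fin.remQuot-combine {m} i zero)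
  from-to (i , just v)  = trans
    (cong (λ (j , y) → j , fromColumn y) (Fin.remQuot-combine {m} i (suc (index v))))
    (cong (λ u → i , just u) (element-index v))

R-hom : ∀ {G G′ m m′} (ι : Fin m → Fin m′) → Injective _≡_ _≡_ ι →
  Hom G G′ → Hom (R m G) (R m′ G′)
R-hom {G} {G′} {m} {m′} ι ι-inj φ = record { map = R-map ; preserves = R-preserves }
  where
  R-map : Vertex (R m G) → Vertex (R m′ G′)
  R-map (i , v) = ι i , Maybe.map (Hom.map φ) v
  R-preserves : ∀ x y → Adj (R m G) x y → Adj (R m′ G′) (R-map x) (R-map y)
  R-preserves (_ , nothing) (_ , just _)  (inj₁ (i≡j , tt))   = inj₁ (cong ι i≡j , tt)
  R-preserves (_ , just _)  (_ , nothing) (inj₁ (i≡j , tt))   = inj₁ (cong ι i≡j , tt)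
  R-preserves (_ , just u)  (_ , just w)  (inj₂ (i≢j , u~w)) =
    inj₂ (i≢j ∘ ι-inj , Hom.preserves φ u w u~w)

pullbackModel : ∀ {G G′ c} → Hom G G′ → IntervalModel G′ c → IntervalModel G c
pullbackModel φ M = record
  { weakModel = record
    { lo = lo ∘ map ; hi = hi ∘ map ; meet = meet ∘ preserves _ _
    ; colourable = λ t → pullback φ (λ _ p → p) (colourable t)
    }
  ; lo≤hi = lo≤hi ∘ map
  }
  where
  open IntervalModel M
  open Hom φ

weakenModel : ∀ {G c c′} → c ≤ c′ → IntervalModel G c → IntervalModel G c′
weakenModel c≤c′ M = record
  { weakModel = record
    { lo = lo ; hi = hi ; meet = meet
    ; colourable = λ t → weaken c≤c′ (colourable t)
    }
  ; lo≤hi = lo≤hi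
  }
  where open IntervalModel M

-- Surplus rows are discarded by pulling back along inclusions.
lowerModel : ∀ {G n k ℓ m} → Finite (Vertex G) n → 2 + n ≤ m → rowCount (suc k) ≤ ℓ →
  IntervalModel (R ℓ (R m G)) (suc k) → IntervalModel G k
lowerModel {G} {n} {k} F 2+n≤m rows≤ℓ M =
  [ (λ C → FiniteGraphModels.oneBag G n F (lowerColouring G n k F
      (pullback (R-hom inject₁ Fin.inject₁-injective idHom) (λ _ _ → tt) C)))
  , Fill.intervalModel G n k F
  ]′ (dichotomy (pullbackModel (inclusion rows≤ℓ (inclusion 2+n≤m idHom)) M))
  where
  inclusion : ∀ {G G′ m m′} → m ≤ m′ → Hom G G′ → Hom (R m G) (R m′ G′)
  inclusion m≤m′ = R-hom (λ i → inject≤ i m≤m′) (Fin.inject≤-injective m≤m′ m≤m′ _ _)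

-- With `K` for `suc k`, the count is `3K + 7`, whereas `n ≥ K ≥ 1` and `m ≥ 2K + 2` give
-- `ℓ ≥ 5K + 7`.
rowCount≤ : ∀ {k n ℓ m} → suc k ≤ n → m ≥ n + suc k + 2 → ℓ ≥ m * (n + 1) + suc k + 3 →
  rowCount (suc k) ≤ ℓ
rowCount≤ {k} {n} {ℓ} {m} k<n m≥ ℓ≥ = begin
  rowCount (suc k)                           ≤⟨ m≤m+n _ (2 * k + 2) ⟩
  rowCount (suc k) + (2 * k + 2)             ≡⟨ identity k ⟩
  (suc k + suc k + 2) * (1 + 1) + suc k + 3  ≤⟨ +-monoˡ-≤ 3 (+-monoˡ-≤ (suc k) (*-mono-≤
    (≤-trans (+-monoˡ-≤ 2 (+-monoˡ-≤ (suc k) k<n)) m≥)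
    (+-monoˡ-≤ 1 (≤-trans (s≤s z≤n) k<n)))) ⟩
  m * (n + 1) + suc k + 3                    ≤⟨ ℓ≥ ⟩
  ℓ                                          ∎
  where
  open ≤-Reasoning
  identity : ∀ k → (2 + suc k) + suc ((2 + suc k) + suc (1 + suc k)) + (2 * k + 2) ≡
                   (suc k + suc k + 2) * (1 + 1) + suc k + 3
  identity = solve-∀

theorem1p3 : (G : Graph) (k n : ℕ) →
    IsPathChromaticNumber G k → Vertex G ↔ Fin n →
    (ℓ m : ℕ) → m ≥ n + k + 2 → ℓ ≥ m * (n + 1) + k + 3 →
    ∃[ k′ ] (IsPathChromaticNumber (R ℓ (R m G)) k′ × k < k′)
theorem1p3 G k n χ V↔n ℓ m m≥ ℓ≥ =
  k′ , leastModel⇒pathChromatic (M′ , min′) , ≰⇒> λ k′≤k → noModel k χ m≥ ℓ≥ (weakenModel k′≤k M′)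
  where
  F : Finite (Vertex G) n
  F = record { index = Inverse.to V↔n ; element = Inverse.from V↔n
             ; element-index = Inverse.strictlyInverseʳ V↔n }
  open FiniteGraphModels (R ℓ (R m G)) (ℓ * suc (m * suc n)) (R-finite {R m G} ℓ (R-finite {G} m F))
    using (leastModel⇒pathChromatic; pathChromaticNumber)
  k′ = proj₁ pathChromaticNumber
  M′ = proj₁ (proj₂ pathChromaticNumber)
  min′ = proj₂ (proj₂ pathChromaticNumber)
  noModel : ∀ k → IsPathChromaticNumber G k → m ≥ n + k + 2 → ℓ ≥ m * (n + 1) + k + 3 →
    ¬ IntervalModel (R ℓ (R m G)) k
  -- As `ℓ ≥ 3`, there is a centre `x`, and it needs a colour.
  noModel zero χ m≥ ℓ≥ M = n≮0 (bound (colourable (lo x)) x (≤-refl , lo≤hi x))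
    where
    open IntervalModel M
    x : Vertex (R ℓ (R m G))
    x = fromℕ< (≤-trans (m≤n+m 1 _) (≤-trans (+-monoʳ-≤ (m * (n + 1) + 0) (s≤s z≤n)) ℓ≥)) , nothing
  noModel (suc k) χ m≥ ℓ≥ M = 1+n≰n (χ-least k (lowerModel F 2+n≤m (rowCount≤ k<n m≥ ℓ≥) M))
    where
    χ-least = FiniteGraphModels.pathChromatic⇒least G n F χ
    k<n : suc k ≤ n
    -- One bag with all colours distinct uses `n` colours.
    k<n = χ-least n (FiniteGraphModels.oneBag G n F (FiniteGraph.injectiveColouring G n F))
    2+n≤m : 2 + n ≤ m
    2+n≤m = ≤-trans (subst (_≤ n + suc k + 2) (+-comm n 2) (+-monoˡ-≤ 2 (m≤m+n n (suc k)))) m≥
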